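{- Let $F:P\to\mathbb R^{\mathbf C}$ be a nontrivial, $\mathbb R$-linear, neutral cardinal welfare function. Then $F$ satisfies the IIA criterion if and only if $|\lambda|=2$.
   Context: Fix an integer $n\ge 2$ and a set $\mathbf C$ of $n$ candidates. Fix a composition $\lambda=(\lambda_1,\dots,\lambda_m)$ of $n$ (positive integers with $\sum_i\lambda_i=n$), write $|\lambda|=m$ and $[m]=\{1,\dots,m\}$. A ballot is a function $b:\mathbf C\to[m]$ with $|b^{ -1}(i)|=\lambda_i$ for every $i$; $\mathbf C_\lambda$ denotes the set of ballots. The profile space is $P=\mathbb R^{\mathbf C_\lambda}$ with basis $\{\delta_b\}$ (indicator functions) and inner product $\mathbf p\cdot\mathbf q=\sum_b\mathbf p(b)\mathbf q(b)$. For candidates $X,Y$: $\mathbf a_{X>Y}=\sum_{b:\,b(X)<b(Y)}\delta_b$. Two profiles are $X,Y$-equivalent, $\mathbf p\sim_{X,Y}\mathbf q$, if $(\mathbf p-\mathbf q)\cdot\mathbf a_{X>Y}=0$ and $(\mathbf p-\mathbf q)\cdot\mathbf a_{Y>X}=0$. A cardinal welfare function (CWF) is any map $F:P\to\mathbb R^{\mathbf C}$; it is trivial if for every $\mathbf p$ the function $F(\mathbf p):\mathbf C\to\mathbb R$ is constant. The symmetric group $S_{\mathbf C}$ acts on $\mathbf C_\lambda$ by $\sigma.b=b\circ\sigma^{ -1}$, on $P$ by linearly extending $\sigma.\delta_b=\delta_{\sigma.b}$, and on $\mathbb R^{\mathbf C}$ by $(\sigma.f)(X)=f(\sigma^{ -1}X)$;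 $F$ is neutral if $F(\sigma.\mathbf p)=\sigma.F(\mathbf p)$ for all $\sigma,\mathbf p$. $F$ satisfies the IIA criterion (independence of irrelevant alternatives) if for every ordered pair of distinct candidates $X,Y$ and all $\mathbf p,\mathbf q\in P$ with $\mathbf p\sim_{X,Y}\mathbf q$, $F(\mathbf p)(X)>F(\mathbf p)(Y)$ implies $F(\mathbf q)(X)>F(\mathbf q)(Y)$. -}

module Defs where

open import Level using (0ℓ)
open import Data.Nat.Base as ℕ using (ℕ; zero)
import Data.Nat.Properties as ℕ
open import Data.Bool.Base using (if_then_else_)
open import Data.Fin.Base using (Fin; _<_)
open import Data.Fin.Properties using (_≟_; _<?_; all?)
open import Data.Fin.Permutation using (Permutation′; _⟨$⟩ʳ_; _⟨$⟩ˡ_; flip)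
open import Data.List.Base as List using (List; []; _∷_)
open import Data.List.Membership.Propositional using (_∈_)
open import Data.List.Membership.Propositional.Properties
  using (∈-allFin; ∈-cartesianProductWith⁺)
open import Data.List.Relation.Unary.All as ListAll using ()
open import Data.List.Relation.Unary.AllPairs using ([]; _∷_)
open import Data.List.Relation.Unary.Any using (here; there)
open import Data.List.Relation.Unary.Unique.Propositional using (Unique)
import Data.List.Relation.Unary.Unique.Propositional.Properties as Unique
open import Data.Product.Base using (∃-syntax; _×_; _,_)
open import Data.Sum.Base using (_⊎_)
open import Data.Vec.Base as Vec using (Vec; []; _∷_; lookup; tabulate; count)
open import Data.Vec.Properties
  using (≡-dec; lookup∘tabulate; ∷-injective)
open import Data.Vec.Relation.Unary.All using (All)
open import Function.Base using (_∘_)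
open import Function.Bundles using (Func; _⇔_)
open import Algebra.Bundles using (CommutativeRing)
open import Algebra.Apartness.Bundles using (HeytingField; HeytingCommutativeRing)
open import Algebra.Module.Bundles.Raw using (RawLeftModule)
open import Algebra.Module.Morphism.Structures using (module LeftModuleMorphisms)
import Algebra.Definitions.RawMonoid as RawMonoid
import Algebra.Properties.CommutativeMonoid.Sum as Sum
open import Relation.Binary.Bundles using (Setoid)
open import Relation.Binary.Core using (Rel)
open import Relation.Binary.Definitions using (DecidableEquality)
open import Relation.Binary.Structures using (IsStrictPartialOrder)
open import Relation.Binary.PropositionalEquality
  using (_≡_; _≢_; refl; trans; cong; module ≡-Reasoning)
open import Relation.Nullary using (¬_; Dec; yes; no; does; contradiction)
open import Relation.Nullary.Decidable using (map′; recompute)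

-- The real numbers, axiomatised as a Cauchy-complete Archimedean ordered
-- field.  Classically these axioms determine ℝ up to unique isomorphism.
-- The order is not assumed decidable, so the Bishop reals satisfy them too.
record RealNumbers : Set₁ where
  field
    heytingField : HeytingField 0ℓ 0ℓ 0ℓ

  open HeytingField heytingField public
  open HeytingCommutativeRing heytingCommutativeRing public using (commutativeRing)

  infix 4 _<ℝ_
  field
    _<ℝ_                 : Rel Carrier 0ℓ
    isStrictPartialOrder : IsStrictPartialOrder _≈_ _<ℝ_
    #⇔<⊎>                : ∀ {x y} → x # y ⇔ (x <ℝ y ⊎ y <ℝ x)
    +-monoˡ-<            : ∀ {x y} z → x <ℝ y → x + z <ℝ y + z
    *-pos                : ∀ {x y} → 0# <ℝ x → 0# <ℝ y → 0# <ℝ x * y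

  open RawMonoid (CommutativeRing.+-rawMonoid commutativeRing) public using () renaming (_×_ to _·ℕ_)

  IsCauchy : (ℕ → Carrier) → Set
  IsCauchy s = ∀ ε → 0# <ℝ ε →
    ∃[ N ] ∀ i j → N ℕ.≤ i → N ℕ.≤ j → s i - s j <ℝ ε

  _ConvergesTo_ : (ℕ → Carrier) → Carrier → Set
  s ConvergesTo l = ∀ ε → 0# <ℝ ε →
    ∃[ N ] ∀ i → N ℕ.≤ i → (s i - l <ℝ ε) × (l - s i <ℝ ε)

  field
    archimedean : ∀ x → ∃[ k ] x <ℝ k ·ℕ 1#
    complete    : ∀ s → IsCauchy s → ∃[ l ] s ConvergesTo l

  _^ˢ : Set → Setoid 0ℓ 0ℓ
  I ^ˢ = record
    { Carrier       = I → Carrier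
    ; _≈_           = λ f g → ∀ i → f i ≈ g i
    ; isEquivalence = record
      { refl  = λ i → Setoid.refl setoid
      ; sym   = λ f≈g i → Setoid.sym setoid (f≈g i)
      ; trans = λ f≈g g≈h i → Setoid.trans setoid (f≈g i) (g≈h i)
      }
    }

  _^ᴹ : Set → RawLeftModule Carrier 0ℓ 0ℓ
  I ^ᴹ = record
    { Carrierᴹ = I → Carrier
    ; _≈ᴹ_     = Setoid._≈_ (I ^ˢ)
    ; _+ᴹ_     = λ f g i → f i + g i
    ; _*ₗ_     = λ r f i → r * f i
    ; 0ᴹ       = λ _ → 0#
    ; -ᴹ_      = λ f i → - f i
    }

  sumOver : {A : Set} → List A → (A → Carrier) → Carrier
  sumOver xs f = List.foldr _+_ 0# (List.map f xs)

  infix 3 sumOver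
  syntax sumOver xs (λ x → e) = Σ[ x ∈ xs ] e

record Composition (n : ℕ) : Set where
  field
    ∣_∣      : ℕ
    parts    : Vec ℕ ∣_∣
    positive : All (0 ℕ.<_) parts
    sums     : Vec.sum parts ≡ n

open Composition public

module _ {m : ℕ} where

  open Sum ℕ.+-0-commutativeMonoid using (sum; sum-permute; sum-cong-≗)

  HasShape : ∀ {n} → Vec ℕ m → Vec (Fin m) n → Set
  HasShape λs v = ∀ i → count (_≟ i) v ≡ lookup λs i

  private
    indicator : Fin m → Fin m → ℕ
    indicator i x = if does (x ≟ i) then 1 else 0

    count-sum : ∀ {n} (i : Fin m) (v : Vec (Fin m) n) →
                count (_≟ i) v ≡ sum (λ X → indicator i (lookup v X))
    count-sum i []      = refl
    count-sum i (x ∷ v) with x ≟ i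
    ... | yes _ = cong ℕ.suc (count-sum i v)
    ... | no  _ = count-sum i v

  count-permute : ∀ {n} (i : Fin m) (v : Vec (Fin m) n) (π : Permutation′ n) →
                  count (_≟ i) (tabulate (λ X → lookup v (π ⟨$⟩ʳ X))) ≡ count (_≟ i) v
  count-permute {n} i v π = begin
    count (_≟ i) (tabulate w)                        ≡⟨ count-sum i (tabulate w) ⟩
    sum (λ X → indicator i (lookup (tabulate w) X))  ≡⟨ sum-cong-≗ {n} tabulated ⟩
    sum (λ X → indicator i (w X))                    ≡⟨ sum-permute (indicator i ∘ lookup v) π ⟨
    sum (λ X → indicator i (lookup v X))             ≡⟨ count-sum i v ⟨
    count (_≟ i) v                                   ∎
    where
    open ≡-Reasoning
    w : Fin n → Fin m
    w X = lookup v (π ⟨$⟩ʳ X)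
    tabulated : ∀ X → indicator i (lookup (tabulate w) X) ≡ indicator i (w X)
    tabulated X = cong (indicator i) (lookup∘tabulate w X)

  allVecs : ∀ n → List (Vec (Fin m) n)
  allVecs zero      = [] ∷ []
  allVecs (ℕ.suc n) = List.cartesianProductWith _∷_ (List.allFin m) (allVecs n)

  ∈-allVecs : ∀ {n} (v : Vec (Fin m) n) → v ∈ allVecs n
  ∈-allVecs []      = here refl
  ∈-allVecs (x ∷ v) = ∈-cartesianProductWith⁺ _∷_ (∈-allFin x) (∈-allVecs v)

  allVecs-unique : ∀ n → Unique (allVecs n)
  allVecs-unique zero      = ListAll.[] ∷ []
  allVecs-unique (ℕ.suc n) =
    Unique.cartesianProductWith⁺ _∷_ ∷-injective (Unique.allFin⁺ m) (allVecs-unique n)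

-- Candidates are Fin n, and ranks are Fin ∣ Λ ∣.  A ballot is stored as its
-- table of values, with an irrelevant proof of its shape, so that two ballots
-- are propositionally equal as soon as they agree as functions.
record Ballot {n : ℕ} (Λ : Composition n) : Set where
  constructor ballot
  field
    ranks     : Vec (Fin ∣ Λ ∣) n
    .hasShape : HasShape (parts Λ) ranks

  rank : Fin n → Fin ∣ Λ ∣
  rank = lookup ranks

open Ballot public

module _ {n : ℕ} {Λ : Composition n} where

  ranks-injective : {b c : Ballot Λ} → ranks b ≡ ranks c → b ≡ c
  ranks-injective refl = refl

  infix 4 _≟ᴮ_
  _≟ᴮ_ : DecidableEquality (Ballot Λ)
  b ≟ᴮ c = map′ ranks-injective (cong ranks) (≡-dec _≟_ (ranks b) (ranks c))

  infixr 8 _•_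
  _•_ : Permutation′ n → Ballot Λ → Ballot Λ
  σ • ballot v s = ballot (tabulate (λ X → lookup v (σ ⟨$⟩ˡ X)))
                          (λ i → trans (count-permute i v (flip σ)) (s i))

  private
    hasShape? : (v : Vec (Fin ∣ Λ ∣) n) → Dec (HasShape (parts Λ) v)
    hasShape? v = all? (λ i → count (_≟ i) v ℕ.≟ lookup (parts Λ) i)

  withShape : List (Vec (Fin ∣ Λ ∣) n) → List (Ballot Λ)
  withShape []       = []
  withShape (v ∷ vs) with hasShape? v
  ... | yes s = ballot v s ∷ withShape vs
  ... | no  _ = withShape vs

  ∈-withShape : ∀ {vs} (b : Ballot Λ) → ranks b ∈ vs → b ∈ withShape vs
  ∈-withShape {v ∷ vs} b@(ballot _ s) b∈ with hasShape? v | b∈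
  ... | yes _ | here refl = here refl
  ... | yes _ | there b∈′ = there (∈-withShape b b∈′)
  ... | no ¬s | here refl =
    contradiction (λ i → recompute (_ ℕ.≟ _) (s i)) ¬s
  ... | no  _ | there b∈′ = ∈-withShape b b∈′

  withShape-unique : ∀ {vs} → Unique vs → Unique (withShape vs)
  withShape-unique {[]}     []       = []
  withShape-unique {v ∷ vs} (v∉ ∷ u) with hasShape? v
  ... | yes s = fresh v∉ ∷ withShape-unique u
    where
    fresh : ∀ {ws} → ListAll.All (v ≢_) ws →
            ListAll.All (ballot v s ≢_) (withShape ws)
    fresh {[]}     ListAll.[]          = ListAll.[]
    fresh {w ∷ ws} (v≢w ListAll.∷ v∉′) with hasShape? w
    ... | yes _ = (v≢w ∘ cong ranks) ListAll.∷ fresh v∉′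
    ... | no  _ = fresh v∉′
  ... | no  _ = withShape-unique u

ballots : ∀ {n} (Λ : Composition n) → List (Ballot Λ)
ballots {n} Λ = withShape (allVecs n)

∈-ballots : ∀ {n} {Λ : Composition n} (b : Ballot Λ) → b ∈ ballots Λ
∈-ballots b = ∈-withShape b (∈-allVecs (ranks b))

ballots-unique : ∀ {n} (Λ : Composition n) → Unique (ballots Λ)
ballots-unique {n} Λ = withShape-unique (allVecs-unique n)

module Voting (ℝ : RealNumbers) {n : ℕ} (Λ : Composition n) where

  open RealNumbers ℝ

  Profile : Set
  Profile = Ballot Λ → Carrier

  δ : Ballot Λ → Profile
  δ b c = if does (b ≟ᴮ c) then 1# else 0#

  infix 7 _∙_
  _∙_ : Profile → Profile → Carrier
  p ∙ q = Σ[ b ∈ ballots Λ ] p b * q b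

  infixl 6 _−_
  _−_ : Profile → Profile → Profile
  (p − q) b = p b - q b

  a[_>_] : Fin n → Fin n → Profile
  a[ X > Y ] c = Σ[ b ∈ List.filter (λ b → rank b X <? rank b Y) (ballots Λ) ] δ b c

  infix 4 _∼[_,_]_
  _∼[_,_]_ : Profile → Fin n → Fin n → Profile → Set
  p ∼[ X , Y ] q = ((p − q) ∙ a[ X > Y ] ≈ 0#) × ((p − q) ∙ a[ Y > X ] ≈ 0#)

  -- The linear extension of δ b ↦ δ (σ • b).
  infixr 8 _◦_
  _◦_ : Permutation′ n → Profile → Profile
  (σ ◦ p) c = Σ[ b ∈ ballots Λ ] p b * δ (σ • b) c

  -- Equality of reals is the setoid equality _≈_, so an arbitrary map is one
  -- that respects it.
  CWF : Set
  CWF = Func (Ballot Λ ^ˢ) (Fin n ^ˢ)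

  Trivial : CWF → Set
  Trivial F = ∀ p X Y → F .Func.to p X ≈ F .Func.to p Y

  Linear : CWF → Set
  Linear F = LeftModuleMorphisms.IsLeftModuleHomomorphism
               (Ballot Λ ^ᴹ) (Fin n ^ᴹ) (F .Func.to)

  Neutral : CWF → Set
  Neutral F = ∀ σ p X → F .Func.to (σ ◦ p) X ≈ F .Func.to p (σ ⟨$⟩ˡ X)

  IIA : CWF → Set
  IIA F = ∀ X Y → X ≢ Y → ∀ p q → p ∼[ X , Y ] q →
          F .Func.to p Y <ℝ F .Func.to p X → F .Func.to q Y <ℝ F .Func.to q X

{-# OPTIONS --safe #-}

-- A linear neutral F is a positional scoring rule: because S_C acts
-- transitively on pairs (ballot, candidate) with a prescribed rank, there are
-- scores w with F(p)(X) = Σ_b p(b) w(b(X)).  Linearity turns the IIA criterion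
-- into "F(p)(X) = F(p)(Y) whenever p ∼ 0".  Applied to p = δ_b - δ_c, with X
-- above Y on both b and c, it says that w(i) - w(j) is the same real number for
-- all i < j; as soon as there are three ranks this number is 0, and F is
-- trivial.  With two ranks, F(p)(X) - F(p)(Y) is a multiple of
-- p · a_{X>Y} - p · a_{Y>X}, so IIA holds.
module Submission where

open import Defs
open import Algebra.Bundles using (CommutativeRing)
import Algebra.Properties.AbelianGroup as AbelianGroupProperties
import Algebra.Properties.CommutativeSemigroup as CommutativeSemigroupProperties
import Algebra.Properties.Ring as RingProperties
open import Algebra.Module.Morphism.Structures using (module LeftModuleMorphisms)
open import Data.Bool.Base using (if_then_else_)
open import Data.Fin.Base using (Fin; zero; suc; _<_; punchIn; punchOut)
open import Data.Fin.Patterns using (0F; 1F; 2F)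
open import Data.Fin.Permutation
  using (Permutation; Permutation′; _⟨$⟩ʳ_; _⟨$⟩ˡ_; id; insert; insert-punchIn; inverseˡ; inverseʳ)
open import Data.Fin.Properties using (_≟_; _<?_; <⇒≢; punchIn-punchOut)
open import Data.List.Base as List using (List; []; _∷_)
open import Data.List.Membership.Propositional using (_∈_)
open import Data.List.Membership.Propositional.Properties using (∈-filter⁺; ∈-filter⁻)
import Data.List.Relation.Unary.All as ListAll
open import Data.List.Relation.Unary.AllPairs using ([]; _∷_)
open import Data.List.Relation.Unary.Any using (here; there)
open import Data.List.Relation.Unary.Unique.Propositional using (Unique)
import Data.List.Relation.Unary.Unique.Propositional.Properties as Unique
open import Data.Nat.Base as ℕ using (ℕ; _≤_; z≤n; s≤s)
import Data.Nat.Properties as ℕ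
open import Data.Product.Base using (∃-syntax; _×_; _,_; proj₁; proj₂; swap)
open import Data.Sum.Base using ([_,_]′)
open import Data.Vec.Base using (Vec; []; _∷_; lookup; tabulate; count; removeAt)
open import Data.Vec.Membership.Propositional.Properties using (∈-lookup)
open import Data.Vec.Properties using (lookup∘tabulate; tabulate∘lookup; tabulate-cong)
import Data.Vec.Relation.Unary.All as VecAll
open import Function.Base using (_∘_)
open import Function.Bundles using (Func; Equivalence; _⇔_; mk⇔)
open import Relation.Binary.Definitions using (DecidableEquality)
open import Relation.Binary.PropositionalEquality as ≡
  using (_≡_; _≢_; refl; cong; subst; subst₂; module ≡-Reasoning)
import Relation.Binary.Reasoning.Setoid as SetoidReasoning
open import Relation.Binary.Structures using (IsStrictPartialOrder)
open import Relation.Nullary using (¬_; Dec; yes; no; does; contradiction)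
open import Relation.Nullary.Decidable using (dec-true; dec-false; recompute)
open import Relation.Unary using (Pred; Decidable)

-- Counting the entries of a vector.

module _ {a} {A : Set a} where

  lookup-removeAt : ∀ {n} (xs : Vec A (ℕ.suc n)) i k →
                    lookup (removeAt xs i) k ≡ lookup xs (punchIn i k)
  lookup-removeAt (x ∷ xs)     zero    k       = refl
  lookup-removeAt (x ∷ y ∷ xs) (suc i) zero    = refl
  lookup-removeAt (x ∷ y ∷ xs) (suc i) (suc k) = lookup-removeAt (y ∷ xs) i k

  module _ {p} {P : Pred A p} (P? : Decidable P) where

    -- Counts ignore order. In the inductive step the extracted entry passes the head, so testing
    -- these two entries reduces the claim to the shorter vector.
    count-removeAt : ∀ {n} (xs : Vec A (ℕ.suc n)) i →
                     count P? (lookup xs i ∷ removeAt xs i) ≡ count P? xs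
    count-removeAt (x ∷ xs)     zero    = refl
    count-removeAt (x ∷ y ∷ xs) (suc i)
      with P? x | P? (lookup (y ∷ xs) i) | count-removeAt (y ∷ xs) i
    ... | yes _ | yes _ | eq = cong ℕ.suc eq
    ... | yes _ | no  _ | eq = cong ℕ.suc eq
    ... | no  _ | yes _ | eq = eq
    ... | no  _ | no  _ | eq = eq

    count>0⇒∃ : ∀ {n} (xs : Vec A n) → 0 ℕ.< count P? xs → ∃[ i ] P (lookup xs i)
    count>0⇒∃ (x ∷ xs) c>0 with P? x
    ... | yes px = zero , px
    ... | no  _  with i , pi ← count>0⇒∃ xs c>0 = suc i , pi

    head⇒count>0 : ∀ {n} {x} (xs : Vec A n) → P x → 0 ℕ.< count P? (x ∷ xs)
    head⇒count>0 {x = x} xs px with P? x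
    ... | yes _  = s≤s z≤n
    ... | no ¬px = contradiction px ¬px

    count-∷-cancel : ∀ {m n} x (xs : Vec A m) (ys : Vec A n) →
                     count P? (x ∷ xs) ≡ count P? (x ∷ ys) → count P? xs ≡ count P? ys
    count-∷-cancel x xs ys eq with P? x
    ... | yes _ = ℕ.suc-injective eq
    ... | no  _ = eq

-- Permutations with prescribed values.

insert-at : ∀ {m n} i j (π : Permutation m n) → insert i j π ⟨$⟩ʳ i ≡ j
insert-at i j π with i ≟ i
... | yes _   = refl
... | no  i≢i = contradiction refl i≢i

module _ {a} {A : Set a} (_≟ᴬ_ : DecidableEquality A) where

  SameCounts : ∀ {n} → Vec A n → Vec A n → Set a
  SameCounts xs ys = ∀ x → count (_≟ᴬ x) xs ≡ count (_≟ᴬ x) ys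

  Aligns : ∀ {n} → Permutation′ n → Vec A n → Vec A n → Set a
  Aligns π xs ys = ∀ k → lookup xs k ≡ lookup ys (π ⟨$⟩ʳ k)

  SameCounts-removeAt : ∀ {n} (xs ys : Vec A (ℕ.suc n)) i j →
                        lookup xs i ≡ lookup ys j → SameCounts xs ys →
                        SameCounts (removeAt xs i) (removeAt ys j)
  SameCounts-removeAt xs ys i j eq same x =
    count-∷-cancel (_≟ᴬ x) (lookup xs i) (removeAt xs i) (removeAt ys j) (begin
    count (_≟ᴬ x) (lookup xs i ∷ removeAt xs i)  ≡⟨ count-removeAt (_≟ᴬ x) xs i ⟩
    count (_≟ᴬ x) xs                             ≡⟨ same x ⟩
    count (_≟ᴬ x) ys                             ≡⟨ count-removeAt (_≟ᴬ x) ys j ⟨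
    count (_≟ᴬ x) (lookup ys j ∷ removeAt ys j)  ≡⟨ cong (λ y → count (_≟ᴬ x) (y ∷ removeAt ys j)) eq ⟨
    count (_≟ᴬ x) (lookup xs i ∷ removeAt ys j)  ∎)
    where open ≡-Reasoning

  insert-aligns : ∀ {n} (xs ys : Vec A (ℕ.suc n)) i j π → lookup xs i ≡ lookup ys j →
                  Aligns π (removeAt xs i) (removeAt ys j) → Aligns (insert i j π) xs ys
  insert-aligns xs ys i j π eq aligned k with i ≟ k
  ... | yes refl = eq
  ... | no  i≢k  = begin
    lookup xs k                                              ≡⟨ cong (lookup xs) (punchIn-punchOut i≢k) ⟨
    lookup xs (punchIn i (punchOut i≢k))                     ≡⟨ lookup-removeAt xs i _ ⟨
    lookup (removeAt xs i) (punchOut i≢k)                    ≡⟨ aligned (punchOut i≢k) ⟩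
    lookup (removeAt ys j) (π ⟨$⟩ʳ punchOut i≢k)             ≡⟨ lookup-removeAt ys j _ ⟩
    lookup ys (punchIn j (π ⟨$⟩ʳ punchOut i≢k))              ∎
    where open ≡-Reasoning

  -- Induction on the length: the head `x` has a positive count in `ys`, hence occurs there at some
  -- `j`. Removing both occurrences keeps all counts equal, and `insert` restores the matched pair.
  aligning-permutation : ∀ {n} (xs ys : Vec A n) → SameCounts xs ys → ∃[ π ] Aligns π xs ys
  aligning-permutation []         []  same = id , λ ()
  aligning-permutation (x ∷ xs) ys@(_ ∷ _) same
    with j , ysj≡x ← count>0⇒∃ (_≟ᴬ x) ys
           (subst (0 ℕ.<_) (same x) (head⇒count>0 (_≟ᴬ x) xs refl))
    with π , aligned ← aligning-permutation xs (removeAt ys j)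
           (SameCounts-removeAt (x ∷ xs) ys zero j (≡.sym ysj≡x) same)
    = insert zero j π , insert-aligns (x ∷ xs) ys zero j π (≡.sym ysj≡x) aligned

  -- The pair `i`, `j` is matched first and the remaining entries are aligned arbitrarily. This
  -- control over one pair lets a chosen candidate travel with its ballot.
  aligning-permutation-at : ∀ {n} (xs ys : Vec A n) → SameCounts xs ys →
                            ∀ {i j} → lookup xs i ≡ lookup ys j →
                            ∃[ π ] Aligns π xs ys × π ⟨$⟩ʳ i ≡ j
  aligning-permutation-at xs@(_ ∷ _) ys same {i} {j} eq
    with π , aligned ← aligning-permutation (removeAt xs i) (removeAt ys j)
           (SameCounts-removeAt xs ys i j eq same)
    = insert i j π , insert-aligns xs ys i j π eq aligned , insert-at i j π

-- Double transitivity of the symmetric group. The outer `insert` settles the first pair; the inner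
-- one settles the second, renumbered by `punchOut` once the first is removed.
permutation-through : ∀ {n} {i i′ j j′ : Fin n} → i ≢ i′ → j ≢ j′ →
                      ∃[ π ] π ⟨$⟩ʳ i ≡ j × π ⟨$⟩ʳ i′ ≡ j′
permutation-through {1}             {0F} {0F} i≢i′ _ = contradiction refl i≢i′
permutation-through {ℕ.suc (ℕ.suc n)} {i} {i′} {j} {j′} i≢i′ j≢j′ =
  π , insert-at i j ρ , (begin
    π ⟨$⟩ʳ i′                           ≡⟨ cong (π ⟨$⟩ʳ_) (punchIn-punchOut i≢i′) ⟨
    π ⟨$⟩ʳ punchIn i (punchOut i≢i′)    ≡⟨ insert-punchIn i j ρ _ ⟩
    punchIn j (ρ ⟨$⟩ʳ punchOut i≢i′)    ≡⟨ cong (punchIn j) (insert-at (punchOut i≢i′) (punchOut j≢j′) id) ⟩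
    punchIn j (punchOut j≢j′)           ≡⟨ punchIn-punchOut j≢j′ ⟩
    j′                                  ∎)
  where
  open ≡-Reasoning
  ρ : Permutation′ (ℕ.suc n)
  ρ = insert (punchOut i≢i′) (punchOut j≢j′) id
  π : Permutation′ (ℕ.suc (ℕ.suc n))
  π = insert i j ρ

-- The symmetric group acting on ballots.

module _ {n : ℕ} {Λ : Composition n} where

  -- The parts of a composition are positive, so no rank is empty. The shape proof is irrelevant and
  -- is recovered by deciding equality of naturals.
  rank-surjective : (b : Ballot Λ) → ∀ i → ∃[ X ] rank b X ≡ i
  rank-surjective (ballot v s) i = count>0⇒∃ (_≟ i) v
    (subst (0 ℕ.<_) (≡.sym (recompute (_ ℕ.≟ _) (s i)))
      (VecAll.lookup (positive Λ) (∈-lookup i (parts Λ))))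

  rank-• : ∀ σ (b : Ballot Λ) X → rank (σ • b) (σ ⟨$⟩ʳ X) ≡ rank b X
  rank-• σ b X = ≡.trans (lookup∘tabulate _ (σ ⟨$⟩ʳ X)) (cong (rank b) (inverseˡ σ))

  -- Ballots of one shape use each rank equally often, so their tables can be aligned; the equal
  -- ranks of `X` and `Y` allow this pair to be matched.
  •-transitive : (b c : Ballot Λ) → ∀ {X Y} → rank b X ≡ rank c Y →
                 ∃[ σ ] σ • b ≡ c × σ ⟨$⟩ʳ X ≡ Y
  •-transitive b@(ballot v s) c@(ballot w t) eq
    with σ , aligned , σX≡Y ← aligning-permutation-at _≟_ v w
           (λ i → recompute (_ ℕ.≟ _) (≡.trans (s i) (≡.sym (t i)))) eq
    = σ , ranks-injective σ•v≡w , σX≡Y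
    where
    open ≡-Reasoning
    σ•v≡w : ranks (σ • b) ≡ w
    σ•v≡w = begin
      tabulate (λ Z → lookup v (σ ⟨$⟩ˡ Z))             ≡⟨ tabulate-cong (λ Z → aligned (σ ⟨$⟩ˡ Z)) ⟩
      tabulate (λ Z → lookup w (σ ⟨$⟩ʳ (σ ⟨$⟩ˡ Z)))    ≡⟨ tabulate-cong (λ Z → cong (lookup w) (inverseʳ σ)) ⟩
      tabulate (lookup w)                              ≡⟨ tabulate∘lookup w ⟩
      w                                                ∎

-- Order, finite sums and score vectors over the reals.

module RealProperties (ℝ : RealNumbers) where

  open RealNumbers ℝ
    using (Carrier; _≈_; _+_; _*_; -_; _-_; 0#; 1#; _<ℝ_; sumOver; tight; #⇔<⊎>; +-monoˡ-<;
           isStrictPartialOrder; commutativeRing)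
  module R = CommutativeRing commutativeRing
  open AbelianGroupProperties R.+-abelianGroup
    using (xyx⁻¹≈y; ⁻¹-∙-comm; ε⁻¹≈ε; x∙y⁻¹≈ε⇒x≈y; ⁻¹-anti-homo‿-)
  open RingProperties R.ring using (-‿distribʳ-*)
  open CommutativeSemigroupProperties R.+-commutativeSemigroup using (interchange)
  open SetoidReasoning R.setoid
  module < = IsStrictPartialOrder isStrictPartialOrder

  -‿cong₂ : ∀ {x x′ y y′} → x ≈ x′ → y ≈ y′ → x - y ≈ x′ - y′
  -‿cong₂ x≈x′ y≈y′ = R.+-cong x≈x′ (R.-‿cong y≈y′)

  x-0≈x : ∀ x → x - 0# ≈ x
  x-0≈x x = R.trans (R.+-congˡ ε⁻¹≈ε) (R.+-identityʳ x)

  x-y≈z-z⇒x≈y : ∀ {x y z} → x - y ≈ z - z → x ≈ y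
  x-y≈z-z⇒x≈y {x} {y} {z} eq = x∙y⁻¹≈ε⇒x≈y x y (R.trans eq (R.-‿inverseʳ z))

  ≮∧≯⇒≈ : ∀ {x y} → ¬ x <ℝ y → ¬ y <ℝ x → x ≈ y
  ≮∧≯⇒≈ {x} {y} x≮y y≮x = proj₁ (tight x y) ([ x≮y , y≮x ]′ ∘ Equivalence.to #⇔<⊎>)

  -- Translation by `v - y` carries `y` to `v` and `x` to `u`.
  <-resp-difference : ∀ {x y u v} → x - y ≈ u - v → y <ℝ x → v <ℝ u
  <-resp-difference {x} {y} {u} {v} eq y<x =
    <.<-respˡ-≈ (shift y y≈) (<.<-respʳ-≈ (shift x eq) (+-monoˡ-< (v - y) y<x))
    where
    y≈ : y - y ≈ v - v
    y≈ = R.trans (R.-‿inverseʳ y) (R.sym (R.-‿inverseʳ v))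
    shift : ∀ z {t} → z - y ≈ t - v → z + (v - y) ≈ t
    shift z {t} z-y≈t-v = begin
      z + (v - y)  ≈⟨ R.+-assoc z v (- y) ⟨
      z + v - y    ≈⟨ R.+-congʳ (R.+-comm z v) ⟩
      v + z - y    ≈⟨ R.+-assoc v z (- y) ⟩
      v + (z - y)  ≈⟨ R.+-congˡ z-y≈t-v ⟩
      v + (t - v)  ≈⟨ R.+-assoc v t (- v) ⟨
      v + t - v    ≈⟨ xyx⁻¹≈y v t ⟩
      t            ∎

  module _ {A : Set} where

    sum-cong : ∀ (xs : List A) {f g : A → Carrier} → (∀ x → f x ≈ g x) →
               sumOver xs f ≈ sumOver xs g
    sum-cong []       f≈g = R.refl
    sum-cong (x ∷ xs) f≈g = R.+-cong (f≈g x) (sum-cong xs f≈g)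

    sum-homo-− : ∀ (xs : List A) (f g : A → Carrier) →
                    sumOver xs (λ x → f x - g x) ≈ sumOver xs f - sumOver xs g
    sum-homo-− []       f g = R.sym (x-0≈x 0#)
    sum-homo-− (x ∷ xs) f g = begin
      (f x - g x) + sumOver xs (λ y → f y - g y)        ≈⟨ R.+-congˡ (sum-homo-− xs f g) ⟩
      (f x - g x) + (sumOver xs f - sumOver xs g)       ≈⟨ interchange (f x) (- g x) (sumOver xs f) (- sumOver xs g) ⟩
      (f x + sumOver xs f) + (- g x - sumOver xs g)     ≈⟨ R.+-congˡ (⁻¹-∙-comm (g x) (sumOver xs g)) ⟩
      (f x + sumOver xs f) - (g x + sumOver xs g)       ∎

    sum-distribˡ-* : ∀ (xs : List A) r (f : A → Carrier) →
                     sumOver xs (λ x → r * f x) ≈ r * sumOver xs f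
    sum-distribˡ-* []       r f = R.sym (R.zeroʳ r)
    sum-distribˡ-* (x ∷ xs) r f = R.trans (R.+-congˡ (sum-distribˡ-* xs r f))
                                          (R.sym (R.distribˡ r (f x) (sumOver xs f)))

    sum-zero : ∀ (xs : List A) {f : A → Carrier} → (∀ {x} → x ∈ xs → f x ≈ 0#) → sumOver xs f ≈ 0#
    sum-zero []       f≈0 = R.refl
    sum-zero (x ∷ xs) f≈0 =
      R.trans (R.+-cong (f≈0 (here refl)) (sum-zero xs (f≈0 ∘ there))) (R.+-identityˡ 0#)

    -- Uniqueness makes `y` occur exactly once, so no multiplicity appears. This evaluates every sum
    -- against a basis profile.
    sum-select : ∀ {xs : List A} {f : A → Carrier} {y} → Unique xs → y ∈ xs →
                 (∀ {x} → x ≢ y → f x ≈ 0#) → sumOver xs f ≈ f y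
    sum-select {x ∷ xs} {f} (x∉xs ∷ _) (here refl) off =
      R.trans (R.+-congˡ (sum-zero xs (λ y∈xs → off (ListAll.lookup x∉xs y∈xs ∘ ≡.sym))))
              (R.+-identityʳ (f x))
    sum-select {x ∷ xs} {f} {y} (x∉xs ∷ unique) (there y∈xs) off =
      R.trans (R.+-cong (off (ListAll.lookup x∉xs y∈xs)) (sum-select unique y∈xs off))
              (R.+-identityˡ (f y))

  -- The real-valued Iverson bracket.
  ⟦_<_⟧ : ∀ {m} → Fin m → Fin m → Carrier
  ⟦ i < j ⟧ = if does (i <? j) then 1# else 0#

  ⟦<⟧-true : ∀ {m} {i j : Fin m} → i < j → ⟦ i < j ⟧ ≡ 1#
  ⟦<⟧-true {i = i} {j} i<j = cong (if_then 1# else 0#) (dec-true (i <? j) i<j)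

  ⟦<⟧-false : ∀ {m} {i j : Fin m} → ¬ i < j → ⟦ i < j ⟧ ≡ 0#
  ⟦<⟧-false {i = i} {j} i≮j = cong (if_then 1# else 0#) (dec-false (i <? j) i≮j)

  -- The factor is the gap between the two scores. The bracket difference is 1, -1 or 0, and is the
  -- pointwise value of `a[ X > Y ] − a[ Y > X ]`.
  two-scores : ∀ {m} → m ≡ 2 → (w : Fin m → Carrier) →
               ∃[ r ] ∀ i j → w i - w j ≈ r * (⟦ i < j ⟧ - ⟦ j < i ⟧)
  two-scores refl w = w 0F - w 1F , difference
    where
    r = w 0F - w 1F

    equal : ∀ i → w i - w i ≈ r * (0# - 0#)
    equal i = begin
      w i - w i      ≈⟨ R.-‿inverseʳ (w i) ⟩
      0#             ≈⟨ R.zeroʳ r ⟨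
      r * 0#         ≈⟨ R.*-congˡ (x-0≈x 0#) ⟨
      r * (0# - 0#)  ∎

    difference : ∀ i j → w i - w j ≈ r * (⟦ i < j ⟧ - ⟦ j < i ⟧)
    difference 0F 0F = equal 0F
    difference 1F 1F = equal 1F
    difference 0F 1F = R.sym (R.trans (R.*-congˡ (x-0≈x 1#)) (R.*-identityʳ r))
    difference 1F 0F = begin
      w 1F - w 0F    ≈⟨ ⁻¹-anti-homo‿- (w 0F) (w 1F) ⟨
      - r            ≈⟨ R.-‿cong (R.*-identityʳ r) ⟨
      - (r * 1#)     ≈⟨ -‿distribʳ-* r 1# ⟩
      r * (- 1#)     ≈⟨ R.*-congˡ (R.+-identityˡ (- 1#)) ⟨
      r * (0# - 1#)  ∎

  -- The hypothesis says that all gaps `w i - w j` with `i < j` agree, rearranged into the shape in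
  -- which a difference of two ballots delivers it.
  equidistant-scores : ∀ {m} → m ≢ 2 → (w : Fin m → Carrier) →
                       (∀ {i j k l} → i < j → k < l → w i - w k ≈ w j - w l) →
                       ∀ i j → w i ≈ w j
  equidistant-scores {1} m≢2 w equidistant 0F 0F = R.refl
  equidistant-scores {2} m≢2 w equidistant i  j  = contradiction refl m≢2
  equidistant-scores {ℕ.suc (ℕ.suc (ℕ.suc m))} m≢2 w equidistant i j =
    R.trans (w≈w1 i) (R.sym (w≈w1 j))
    where
    w≈w1 : ∀ i → w i ≈ w 1F
    -- The gaps from 0 to 2 and from 1 to 2 share an endpoint, which forces `w 0F ≈ w 1F`; below,
    -- the gaps from 0 to `suc i` and from 0 to 1 do likewise.
    w≈w1 0F      = x-y≈z-z⇒x≈y (equidistant {0F} {2F} {1F} {2F} (s≤s z≤n) (s≤s (s≤s z≤n)))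
    w≈w1 (suc i) = x-y≈z-z⇒x≈y (R.sym (equidistant {0F} {suc i} {0F} {1F} (s≤s z≤n) (s≤s z≤n)))

-- Inner products with basis profiles.

module Scoring (ℝ : RealNumbers) {n : ℕ} (Λ : Composition n) where

  open RealNumbers ℝ using (Carrier; _≈_; _+_; _*_; -_; _-_; 0#; 1#; _<ℝ_; sumOver)
  open RealProperties ℝ
  open Voting ℝ Λ
  open AbelianGroupProperties R.+-abelianGroup using (x∙y⁻¹≈ε⇒x≈y; x≈y⇒x∙y⁻¹≈ε)
  open CommutativeSemigroupProperties R.*-commutativeSemigroup using (x∙yz≈y∙xz)
  open RingProperties R.ring using (x[y-z]≈xy-xz; [y-z]x≈yx-zx)
  open SetoidReasoning R.setoid

  δ-diagonal : ∀ b → δ b b ≡ 1#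
  δ-diagonal b = cong (if_then 1# else 0#) (dec-true (b ≟ᴮ b) refl)

  δ-off : ∀ b c → b ≢ c → δ b c ≡ 0#
  δ-off b c b≢c = cong (if_then 1# else 0#) (dec-false (b ≟ᴮ c) b≢c)

  ∙-congˡ : ∀ p {g h} → (∀ b → g b ≈ h b) → p ∙ g ≈ p ∙ h
  ∙-congˡ p g≈h = sum-cong (ballots Λ) (λ b → R.*-congˡ (g≈h b))

  ∙-congʳ : ∀ g {p q} → (∀ b → p b ≈ q b) → p ∙ g ≈ q ∙ g
  ∙-congʳ g p≈q = sum-cong (ballots Λ) (λ b → R.*-congʳ (p≈q b))

  ∙-distribˡ-− : ∀ p g h → p ∙ (g − h) ≈ p ∙ g - p ∙ h
  ∙-distribˡ-− p g h = R.trans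
    (sum-cong (ballots Λ) (λ b → x[y-z]≈xy-xz (p b) (g b) (h b)))
    (sum-homo-− (ballots Λ) (λ b → p b * g b) (λ b → p b * h b))

  ∙-distribʳ-− : ∀ g p q → (p − q) ∙ g ≈ p ∙ g - q ∙ g
  ∙-distribʳ-− g p q = R.trans
    (sum-cong (ballots Λ) (λ b → [y-z]x≈yx-zx (g b) (p b) (q b)))
    (sum-homo-− (ballots Λ) (λ b → p b * g b) (λ b → q b * g b))

  ∙-scaleʳ : ∀ p r g → p ∙ (λ b → r * g b) ≈ r * (p ∙ g)
  ∙-scaleʳ p r g = R.trans
    (sum-cong (ballots Λ) (λ b → x∙yz≈y∙xz (p b) r (g b)))
    (sum-distribˡ-* (ballots Λ) r (λ b → p b * g b))

  δ-∙ : ∀ b g → δ b ∙ g ≈ g b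
  δ-∙ b g = begin
    δ b ∙ g        ≈⟨ sum-select (ballots-unique Λ) (∈-ballots b) (λ {c} c≢b →
                        R.trans (R.*-congʳ (R.reflexive (δ-off b c (c≢b ∘ ≡.sym)))) (R.zeroˡ (g c))) ⟩
    δ b b * g b    ≡⟨ cong (_* g b) (δ-diagonal b) ⟩
    1# * g b       ≈⟨ R.*-identityˡ (g b) ⟩
    g b            ∎

  δ-expansion : ∀ p c → p ∙ (λ b → δ b c) ≈ p c
  δ-expansion p c = begin
    p ∙ (λ b → δ b c)  ≈⟨ sum-select (ballots-unique Λ) (∈-ballots c) (λ {b} b≢c →
                            R.trans (R.*-congˡ (R.reflexive (δ-off b c b≢c))) (R.zeroʳ (p b))) ⟩
    p c * δ c c        ≡⟨ cong (p c *_) (δ-diagonal c) ⟩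
    p c * 1#           ≈⟨ R.*-identityʳ (p c) ⟩
    p c                ∎

  ◦-δ : ∀ σ b c → (σ ◦ δ b) c ≈ δ (σ • b) c
  ◦-δ σ b c = δ-∙ b (λ b′ → δ (σ • b′) c)

  module _ (X Y : Fin n) where

    private
      above? : Decidable (λ (b : Ballot Λ) → rank b X < rank b Y)
      above? b = rank b X <? rank b Y

    a-above : ∀ c → rank c X < rank c Y → a[ X > Y ] c ≈ 1#
    a-above c cX<cY = R.trans
      (sum-select (Unique.filter⁺ above? (ballots-unique Λ)) (∈-filter⁺ above? (∈-ballots c) cX<cY)
        (λ {b} b≢c → R.reflexive (δ-off b c b≢c)))
      (R.reflexive (δ-diagonal c))

    a-not-above : ∀ c → ¬ rank c X < rank c Y → a[ X > Y ] c ≈ 0#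
    a-not-above c cX≮cY = sum-zero (List.filter above? (ballots Λ)) (λ {b} b∈ →
      R.reflexive (δ-off b c (λ { refl → cX≮cY (proj₂ (∈-filter⁻ above? {xs = ballots Λ} b∈)) })))

    a-value : ∀ c → a[ X > Y ] c ≈ ⟦ rank c X < rank c Y ⟧
    a-value c = go (above? c)
      where
      go : Dec (rank c X < rank c Y) → a[ X > Y ] c ≈ ⟦ rank c X < rank c Y ⟧
      go (yes cX<cY) = R.trans (a-above c cX<cY) (R.reflexive (≡.sym (⟦<⟧-true cX<cY)))
      go (no  cX≮cY) = R.trans (a-not-above c cX≮cY) (R.reflexive (≡.sym (⟦<⟧-false cX≮cY)))

  scoring : (Fin ∣ Λ ∣ → Carrier) → Fin n → Profile
  scoring w X b = w (rank b X)

  -- Linear neutral welfare functions as scoring rules.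

  module _ (F : CWF) where

    open Func F renaming (to to ⟪_⟫; cong to ⟪⟫-cong)

    module _ (linear : Linear F) where

      open LeftModuleMorphisms.IsLeftModuleHomomorphism linear using (+ᴹ-homo; *ₗ-homo; 0ᴹ-homo)

      sum-homo : ∀ (xs : List (Ballot Λ)) (p : Profile) X →
                 ⟪ (λ c → Σ[ b ∈ xs ] p b * δ b c) ⟫ X ≈ (Σ[ b ∈ xs ] p b * ⟪ δ b ⟫ X)
      sum-homo []       p X = 0ᴹ-homo X
      sum-homo (b ∷ xs) p X = R.trans (+ᴹ-homo _ _ X)
        (R.+-cong (*ₗ-homo (p b) (δ b) X) (sum-homo xs p X))

      -- A profile equals its expansion in the basis only up to `_≈_`, so congruence of `F` comes
      -- before linearity.
      linear-expansion : ∀ (p : Profile) X → ⟪ p ⟫ X ≈ p ∙ (λ b → ⟪ δ b ⟫ X)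
      linear-expansion p X = R.trans
        (⟪⟫-cong (λ c → R.sym (δ-expansion p c)) X)
        (sum-homo (ballots Λ) p X)

    -- Some permutation carries the pair `b`, `X` to the pair `c`, `Y`, and neutrality transports
    -- the value along it.
    neutral-score : Neutral F → ∀ b c {X Y} → rank b X ≡ rank c Y → ⟪ δ b ⟫ X ≈ ⟪ δ c ⟫ Y
    neutral-score neutral b c {X} eq with σ , refl , refl ← •-transitive b c eq = begin
      ⟪ δ b ⟫ X                        ≡⟨ cong ⟪ δ b ⟫ (inverseˡ σ) ⟨
      ⟪ δ b ⟫ (σ ⟨$⟩ˡ (σ ⟨$⟩ʳ X))      ≈⟨ neutral σ (δ b) (σ ⟨$⟩ʳ X) ⟨
      ⟪ σ ◦ δ b ⟫ (σ ⟨$⟩ʳ X)           ≈⟨ ⟪⟫-cong (◦-δ σ b) (σ ⟨$⟩ʳ X) ⟩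
      ⟪ δ (σ • b) ⟫ (σ ⟨$⟩ʳ X)         ∎

    Scores : (Fin ∣ Λ ∣ → Carrier) → Set
    Scores w = ∀ p X → ⟪ p ⟫ X ≈ p ∙ scoring w X

    -- The head of the list serves as reference ballot: the score of a rank is the value at a
    -- candidate holding that rank there. Working with a list avoids constructing a ballot; for the
    -- empty list the claim is vacuous and 0 is a placeholder.
    ballot-scores : Neutral F → (bs : List (Ballot Λ)) →
                    ∃[ w ] (∀ b → b ∈ bs → ∀ X → ⟪ δ b ⟫ X ≈ scoring w X b)
    ballot-scores neutral []       = (λ _ → 0#) , λ _ ()
    ballot-scores neutral (c ∷ bs) =
      (λ i → ⟪ δ c ⟫ (proj₁ (rank-surjective c i))) ,
      λ b _ X → neutral-score neutral b c (≡.sym (proj₂ (rank-surjective c (rank b X))))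

    scores-exist : Linear F → Neutral F → ∃[ w ] Scores w
    scores-exist linear neutral with w , ⟪δ⟫≈w ← ballot-scores neutral (ballots Λ) =
      w , λ p X → R.trans (linear-expansion linear p X) (∙-congˡ p (λ b → ⟪δ⟫≈w b (∈-ballots b) X))

    -- The IIA criterion in terms of scores.

    module _ (w : Fin ∣ Λ ∣ → Carrier) (scores : Scores w) where

      private
        score : Fin n → Profile
        score = scoring w

      -- Scores are compared only inside a sum over ballots, so the comparison may rely on a ballot
      -- `b` supplied by that sum.
      constant-scores⇒trivial : (∀ (b : Ballot Λ) i j → w i ≈ w j) → Trivial F
      constant-scores⇒trivial constant p X Y = begin
        ⟪ p ⟫ X      ≈⟨ scores p X ⟩
        p ∙ score X  ≈⟨ ∙-congˡ p (λ b → constant b (rank b X) (rank b Y)) ⟩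
        p ∙ score Y  ≈⟨ scores p Y ⟨
        ⟪ p ⟫ Y      ∎

      -- Equivalent profiles have equal margins between `X` and `Y`, not merely margins of equal
      -- sign, so no case distinction on the sign of `r` arises.
      two-ranks⇒IIA : ∣ Λ ∣ ≡ 2 → IIA F
      two-ranks⇒IIA m≡2 X Y _ p q (p∼q , p∼q′) = <-resp-difference (begin
        ⟪ p ⟫ X - ⟪ p ⟫ Y                              ≈⟨ margin p ⟩
        r * (p ∙ a[ X > Y ] - p ∙ a[ Y > X ])          ≈⟨ R.*-congˡ (-‿cong₂ (same a[ X > Y ] p∼q) (same a[ Y > X ] p∼q′)) ⟩
        r * (q ∙ a[ X > Y ] - q ∙ a[ Y > X ])          ≈⟨ margin q ⟨
        ⟪ q ⟫ X - ⟪ q ⟫ Y                              ∎)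
        where
        r = proj₁ (two-scores m≡2 w)

        margin : ∀ p → ⟪ p ⟫ X - ⟪ p ⟫ Y ≈ r * (p ∙ a[ X > Y ] - p ∙ a[ Y > X ])
        margin p = begin
          ⟪ p ⟫ X - ⟪ p ⟫ Y                                      ≈⟨ -‿cong₂ (scores p X) (scores p Y) ⟩
          p ∙ score X - p ∙ score Y                              ≈⟨ ∙-distribˡ-− p (score X) (score Y) ⟨
          p ∙ (score X − score Y)                                ≈⟨ ∙-congˡ p pointwise ⟩
          p ∙ (λ b → r * (a[ X > Y ] − a[ Y > X ]) b)            ≈⟨ ∙-scaleʳ p r _ ⟩
          r * (p ∙ (a[ X > Y ] − a[ Y > X ]))                    ≈⟨ R.*-congˡ (∙-distribˡ-− p _ _) ⟩
          r * (p ∙ a[ X > Y ] - p ∙ a[ Y > X ])                  ∎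
          where
          pointwise : ∀ b → (score X − score Y) b ≈ r * (a[ X > Y ] − a[ Y > X ]) b
          pointwise b = R.trans (proj₂ (two-scores m≡2 w) (rank b X) (rank b Y))
            (R.*-congˡ (R.sym (-‿cong₂ (a-value X Y b) (a-value Y X b))))

        same : ∀ g → (p − q) ∙ g ≈ 0# → p ∙ g ≈ q ∙ g
        same g eq = x∙y⁻¹≈ε⇒x≈y _ _ (R.trans (R.sym (∙-distribʳ-− g p q)) eq)

      module _ (iia : IIA F) where

        -- A strict preference at `p`, in either direction, would pass to the zero profile, where
        -- every candidate has value 0.
        IIA⇒tied : ∀ {X Y p} → X ≢ Y → p ∼[ X , Y ] (λ _ → 0#) → ⟪ p ⟫ X ≈ ⟪ p ⟫ Y
        IIA⇒tied {X} {Y} {p} X≢Y p∼0 = ≮∧≯⇒≈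
          (λ Fx<Fy → unranked Y X (iia Y X (X≢Y ∘ ≡.sym) p _ (swap p∼0) Fx<Fy))
          (λ Fy<Fx → unranked X Y (iia X Y X≢Y p _ p∼0 Fy<Fx))
          where
          zero-score : ∀ Z → ⟪ (λ _ → 0#) ⟫ Z ≈ 0#
          zero-score Z = R.trans (scores _ Z)
            (sum-zero (ballots Λ) (λ {b} _ → R.zeroˡ (score Z b)))
          unranked : ∀ Z W → ¬ ⟪ (λ _ → 0#) ⟫ W <ℝ ⟪ (λ _ → 0#) ⟫ Z
          unranked Z W = <.irrefl (R.trans (zero-score W) (R.sym (zero-score Z)))

        same-order⇒equidistant : ∀ {b c X Y} → rank b X < rank b Y → rank c X < rank c Y →
                                 w (rank b X) - w (rank c X) ≈ w (rank b Y) - w (rank c Y)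
        same-order⇒equidistant {b} {c} {X} {Y} bX<bY cX<cY = begin
          score X b - score X c    ≈⟨ difference (score X) ⟨
          p ∙ score X              ≈⟨ scores p X ⟨
          ⟪ p ⟫ X                  ≈⟨ IIA⇒tied X≢Y (p∼0 above , p∼0 below) ⟩
          ⟪ p ⟫ Y                  ≈⟨ scores p Y ⟩
          p ∙ score Y              ≈⟨ difference (score Y) ⟩
          score Y b - score Y c    ∎
          where
          p : Profile
          -- Both ballots place `X` and `Y` in the same order, so their contributions to each of the
          -- two comparison totals cancel.
          p = δ b − δ c

          X≢Y : X ≢ Y
          X≢Y X≡Y = <⇒≢ bX<bY (cong (rank b) X≡Y)

          difference : ∀ g → p ∙ g ≈ g b - g c
          difference g = R.trans (∙-distribʳ-− g (δ b) (δ c)) (-‿cong₂ (δ-∙ b g) (δ-∙ c g))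

          p∼0 : ∀ {g} → g b ≈ g c → (p − (λ _ → 0#)) ∙ g ≈ 0#
          p∼0 {g} gb≈gc = begin
            (p − (λ _ → 0#)) ∙ g  ≈⟨ ∙-congʳ g (λ b′ → x-0≈x (p b′)) ⟩
            p ∙ g                 ≈⟨ difference g ⟩
            g b - g c             ≈⟨ x≈y⇒x∙y⁻¹≈ε gb≈gc ⟩
            0#                    ∎

          above : a[ X > Y ] b ≈ a[ X > Y ] c
          above = R.trans (a-above X Y b bX<bY) (R.sym (a-above X Y c cX<cY))

          below : a[ Y > X ] b ≈ a[ Y > X ] c
          below = R.trans (a-not-above Y X b (ℕ.<-asym bX<bY)) (R.sym (a-not-above Y X c (ℕ.<-asym cX<cY)))

        -- One ballot suffices: `σ` moves the candidates that `b` ranks `k` and `l` onto those it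
        -- ranks `i` and `j`, so `σ • b` gives the latter the ranks `k` and `l`.
        IIA⇒equidistant : Ballot Λ → ∀ {i j k l} → i < j → k < l → w i - w k ≈ w j - w l
        IIA⇒equidistant b {i} {j} {k} {l} i<j k<l
          with X , refl ← rank-surjective b i | Y , refl ← rank-surjective b j
             | X′ , refl ← rank-surjective b k | Y′ , refl ← rank-surjective b l
          with σ , refl , refl ← permutation-through {i = X′} {Y′} {X} {Y}
                 (λ X′≡Y′ → <⇒≢ k<l (cong (rank b) X′≡Y′)) (λ X≡Y → <⇒≢ i<j (cong (rank b) X≡Y))
          = subst₂ (λ k l → w (rank b X) - w k ≈ w (rank b Y) - w l) (rank-• σ b X′) (rank-• σ b Y′)
              (same-order⇒equidistant {b} {σ • b} i<j
                (subst₂ _<_ (≡.sym (rank-• σ b X′)) (≡.sym (rank-• σ b Y′)) k<l))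

        IIA⇒trivial : ∣ Λ ∣ ≢ 2 → Trivial F
        IIA⇒trivial m≢2 = constant-scores⇒trivial (λ b →
          equidistant-scores m≢2 w (IIA⇒equidistant b))

mainTheorem8 : (ℝ : RealNumbers) (n : ℕ) → 2 ≤ n → (Λ : Composition n) →
    let open Voting ℝ Λ in
    (F : CWF) → ¬ Trivial F → Linear F → Neutral F → IIA F ⇔ ∣ Λ ∣ ≡ 2
mainTheorem8 ℝ n 2≤n Λ F nontrivial linear neutral
  with w , scores ← Scoring.scores-exist ℝ Λ F linear neutral
  = mk⇔ IIA⇒two-ranks (Scoring.two-ranks⇒IIA ℝ Λ F w scores)
  where
  IIA⇒two-ranks : Voting.IIA ℝ Λ F → ∣ Λ ∣ ≡ 2
  -- Deciding equality of naturals keeps the argument by contradiction constructive.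
  IIA⇒two-ranks iia with ∣ Λ ∣ ℕ.≟ 2
  ... | yes m≡2 = m≡2
  ... | no  m≢2 = contradiction (Scoring.IIA⇒trivial ℝ Λ F w scores iia m≢2) nontrivial
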